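{- For a finite simple digraph $\mathcal{G}=(\mathcal{N},\mathcal{A})$ (an instance of BP-FASP), let $\mathcal{P}^1$ and $\mathcal{P}^2$ denote the feasible regions of the linear programming relaxations of BLP #1 and BLP #2 for $\mathcal{G}$, respectively. Then for every instance $\mathcal{P}^1\subseteq\mathcal{P}^2$, and this inclusion can be strict, i.e. there exists an instance for which $\mathcal{P}^1\subsetneq\mathcal{P}^2$.
   Context: A simple digraph has no self-loops and no multiple arcs, but may contain both $(i,j)$ and $(j,i)$. An instance of BP-FASP (the bidirectionality-preserving feedback arc set problem) is a finite simple digraph $\mathcal{G}=(\mathcal{N},\mathcal{A})$ with arc weights $w_{ij}\ge 0$; put $n=|\mathcal{N}|$. Both formulations use binary variables $y_{ij}\in\{0,1\}$ for $i\ne j\in\mathcal{N}$ and minimize $\sum_{(i,j)\in\mathcal{A}}w_{ij}(1-y_{ij})$. BLP #1 has the constraints: (1b) $y_{ij}+y_{ji}\ge 1$ for all distinct $i,j\in\mathcal{N}$ with $(i,j)\in\mathcal{A}$ and $(j,i)\in\mathcal{A}$; (1c) $y_{ij}+y_{ji}=1$ for all distinct $i,j\in\mathcal{N}$ with $(i,j)\notin\mathcal{A}$ or $(j,i)\notin\mathcal{A}$; (1d) $y_{ij}-y_{ik}-y_{kj}\ge -1$ for all pairwise distinct $i,j,k\in\mathcal{N}$. BLP #2 has the constraints (1b), (1c), and, for all distinct $i,j\in\mathcal{N}$: (2a) $\sum_{u\in\mathcal{N}\setminus\{i,j\}}(y_{uj}-y_{ui})\ge (n-2)(y_{ij}-1)$;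 (2b) $\sum_{u\in\mathcal{N}\setminus\{i,j\}}(y_{iu}-y_{ju})\ge (n-2)(y_{ij}-1)$; (2c) $\sum_{u\in\mathcal{N}\setminus\{i,j\}}(y_{iu}+y_{uj})\le (n-2)(y_{ij}+1)$. The LP relaxation of each program replaces $y_{ij}\in\{0,1\}$ by $0\le y_{ij}\le 1$; its feasible region is a subset of $\mathbb{R}^{n(n-1)}$. -}

module Defs where

open import Algebra.Bundles.Raw using (RawMonoid)
import Algebra.Definitions.RawMonoid as RawMonoidDefinitions
open import Data.Bool.Base using (Bool; T)
open import Data.Fin.Base using (Fin)
open import Data.Fin.Properties using (_≟_)
open import Data.Nat.Base as ℕ using (ℕ; _∸_)
import Data.Nat.Properties as ℕ
open import Data.Product.Base using (_×_; _,_; ∃-syntax)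
open import Data.Rational.Base as ℚ using (ℚ; 0ℚ; 1ℚ; ½)
import Data.Rational.Properties as ℚ
open import Data.Rational.Solver using (module +-*-Solver)
open import Data.Sum.Base using (_⊎_)
open import Level using (0ℓ)
open import Relation.Binary.PropositionalEquality
  using (_≡_; _≢_; refl; sym; trans; cong; subst; ≢-sym)
open import Relation.Nullary using (¬_; Dec; yes; no)
open import Relation.Unary using (Pred; _⊆_)

-- Real numbers are Cauchy sequences of rationals, with equality _≈_.

IsCauchy : (ℕ → ℚ) → Set
IsCauchy x = ∀ ε → 0ℚ ℚ.< ε →
  ∃[ N ] (∀ m n → N ℕ.≤ m → N ℕ.≤ n → ℚ.∣ x m ℚ.- x n ∣ ℚ.≤ ε)

record ℝ : Set where
  constructor real
  field
    seq      : ℕ → ℚ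
    isCauchy : IsCauchy seq

open ℝ public

infix 4 _≈_ _≤_ _≥_

_≈_ : ℝ → ℝ → Set
x ≈ y = ∀ ε → 0ℚ ℚ.< ε →
  ∃[ N ] (∀ m → N ℕ.≤ m → ℚ.∣ seq x m ℚ.- seq y m ∣ ℚ.≤ ε)

_≤_ : ℝ → ℝ → Set
x ≤ y = ∀ ε → 0ℚ ℚ.< ε →
  ∃[ N ] (∀ m → N ℕ.≤ m → seq x m ℚ.≤ seq y m ℚ.+ ε)

_≥_ : ℝ → ℝ → Set
x ≥ y = y ≤ x

fromℚ : ℚ → ℝ
fromℚ q = real (λ _ → q) λ ε 0<ε → 0 , λ _ _ _ _ →
  subst (λ d → ℚ.∣ d ∣ ℚ.≤ ε) (sym (ℚ.+-inverseʳ q)) (ℚ.<⇒≤ 0<ε)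

0ℝ 1ℝ : ℝ
0ℝ = fromℚ 0ℚ
1ℝ = fromℚ 1ℚ

private
  open +-*-Solver

  half+half : ∀ ε → ½ ℚ.* ε ℚ.+ ½ ℚ.* ε ≡ ε
  half+half ε = trans (sym (ℚ.*-distribʳ-+ ε ½ ½)) (ℚ.*-identityˡ ε)

  half-pos : ∀ ε → 0ℚ ℚ.< ε → 0ℚ ℚ.< ½ ℚ.* ε
  half-pos ε 0<ε = subst (ℚ._< ½ ℚ.* ε) (ℚ.*-zeroʳ ½) (ℚ.*-monoʳ-<-pos ½ 0<ε)

  +-interchange-- : ∀ a b c d →
    (a ℚ.+ b) ℚ.- (c ℚ.+ d) ≡ (a ℚ.- c) ℚ.+ (b ℚ.- d)
  +-interchange-- = solve 4
    (λ a b c d → (a :+ b) :- (c :+ d) := (a :- c) :+ (b :- d)) refl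

  neg-diff : ∀ a b → (ℚ.- a) ℚ.- (ℚ.- b) ≡ ℚ.- (a ℚ.- b)
  neg-diff = solve 2 (λ a b → (:- a) :- (:- b) := :- (a :- b)) refl

infix  8 -_
infixl 6 _+_ _-_

_+_ : ℝ → ℝ → ℝ
seq (x + y) n = seq x n ℚ.+ seq y n
isCauchy (x + y) ε 0<ε
  with M , x-cauchy ← isCauchy x (½ ℚ.* ε) (half-pos ε 0<ε)
     | N , y-cauchy ← isCauchy y (½ ℚ.* ε) (half-pos ε 0<ε)
  = M ℕ.⊔ N , λ m n p q → let open ℚ.≤-Reasoning in begin
    ℚ.∣ (seq x m ℚ.+ seq y m) ℚ.- (seq x n ℚ.+ seq y n) ∣
      ≡⟨ cong ℚ.∣_∣ (+-interchange-- (seq x m) (seq y m) (seq x n) (seq y n)) ⟩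
    ℚ.∣ (seq x m ℚ.- seq x n) ℚ.+ (seq y m ℚ.- seq y n) ∣
      ≤⟨ ℚ.∣p+q∣≤∣p∣+∣q∣ (seq x m ℚ.- seq x n) (seq y m ℚ.- seq y n) ⟩
    ℚ.∣ seq x m ℚ.- seq x n ∣ ℚ.+ ℚ.∣ seq y m ℚ.- seq y n ∣
      ≤⟨ ℚ.+-mono-≤
           (x-cauchy m n (ℕ.m⊔n≤o⇒m≤o M N p) (ℕ.m⊔n≤o⇒m≤o M N q))
           (y-cauchy m n (ℕ.m⊔n≤o⇒n≤o M N p) (ℕ.m⊔n≤o⇒n≤o M N q)) ⟩
    ½ ℚ.* ε ℚ.+ ½ ℚ.* ε
      ≡⟨ half+half ε ⟩
    ε ∎

-_ : ℝ → ℝ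
seq (- x) n = ℚ.- seq x n
isCauchy (- x) ε 0<ε with N , x-cauchy ← isCauchy x ε 0<ε =
  N , λ m n p q → subst (ℚ._≤ ε)
    (sym (trans (cong ℚ.∣_∣ (neg-diff (seq x m) (seq x n)))
                (ℚ.∣-p∣≡∣p∣ (seq x m ℚ.- seq x n))))
    (x-cauchy m n p q)

_-_ : ℝ → ℝ → ℝ
x - y = x + (- y)

+-0-rawMonoid : RawMonoid 0ℓ 0ℓ
+-0-rawMonoid = record { Carrier = ℝ ; _≈_ = _≈_ ; _∙_ = _+_ ; ε = 0ℝ }

-- k · x is the product of x with the natural number k.
open RawMonoidDefinitions +-0-rawMonoid public
  using (sum) renaming (_×_ to _·_)

-- The node set is Fin n, and the arc set is a decidable set of ordered
-- pairs of nodes (so multiple arcs are excluded).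
record Instance : Set where
  field
    n        : ℕ
    arc      : Fin n → Fin n → Bool
    loopless : ∀ i → ¬ T (arc i i)
    weight   : ∀ i j → T (arc i j) → ℝ
    weight≥0 : ∀ i j (a : T (arc i j)) → weight i j a ≥ 0ℝ

-- ℝ^{n(n-1)}: one coordinate for each ordered pair of distinct nodes.
-- Irrelevance ensures that a coordinate does not depend on the proof of
-- distinctness.
Point : ℕ → Set
Point n = (i j : Fin n) → .(i ≢ j) → ℝ

exceptTerm : ∀ {n} {i j u : Fin n} → Dec (u ≡ i) → Dec (u ≡ j) →
             (u ≢ i → u ≢ j → ℝ) → ℝ
exceptTerm (no u≢i) (no u≢j) x = x u≢i u≢j
exceptTerm _        _        _ = 0ℝ

-- The sum of f u over all u ∉ {i , j}.
sumExcept : ∀ {n} (i j : Fin n) → ((u : Fin n) → u ≢ i → u ≢ j → ℝ) → ℝ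
sumExcept i j f = sum (λ u → exceptTerm (u ≟ i) (u ≟ j) (f u))

module _ (G : Instance) where
  open Instance G

  BidirectionalConstraint : Pred (Point n) 0ℓ
  BidirectionalConstraint y = ∀ i j (i≢j : i ≢ j) →
    T (arc i j) → T (arc j i) →
    y i j i≢j + y j i (≢-sym i≢j) ≥ 1ℝ

  ExclusiveConstraint : Pred (Point n) 0ℓ
  ExclusiveConstraint y = ∀ i j (i≢j : i ≢ j) →
    ¬ T (arc i j) ⊎ ¬ T (arc j i) →
    y i j i≢j + y j i (≢-sym i≢j) ≈ 1ℝ

  TriangleConstraint : Pred (Point n) 0ℓ
  TriangleConstraint y =
    ∀ i j k (i≢j : i ≢ j) (i≢k : i ≢ k) (k≢j : k ≢ j) →
    y i j i≢j - y i k i≢k - y k j k≢j ≥ - 1ℝ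

  -- In the next three constraints i ≢ j forces n ≥ 2, so that the
  -- truncated subtraction n ∸ 2 is the usual one.

  InSumConstraint : Pred (Point n) 0ℓ
  InSumConstraint y = ∀ i j (i≢j : i ≢ j) →
    sumExcept i j (λ u u≢i u≢j → y u j u≢j - y u i u≢i)
      ≥ (n ∸ 2) · (y i j i≢j - 1ℝ)

  OutSumConstraint : Pred (Point n) 0ℓ
  OutSumConstraint y = ∀ i j (i≢j : i ≢ j) →
    sumExcept i j (λ u u≢i u≢j → y i u (≢-sym u≢i) - y j u (≢-sym u≢j))
      ≥ (n ∸ 2) · (y i j i≢j - 1ℝ)

  ThroughSumConstraint : Pred (Point n) 0ℓ
  ThroughSumConstraint y = ∀ i j (i≢j : i ≢ j) →
    sumExcept i j (λ u u≢i u≢j → y i u (≢-sym u≢i) + y u j u≢j)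
      ≤ (n ∸ 2) · (y i j i≢j + 1ℝ)

  record Constraints₁ (y : Point n) : Set where
    field
      bidirectional : BidirectionalConstraint y
      exclusive     : ExclusiveConstraint y
      triangle      : TriangleConstraint y

  record Constraints₂ (y : Point n) : Set where
    field
      bidirectional : BidirectionalConstraint y
      exclusive     : ExclusiveConstraint y
      inSum         : InSumConstraint y
      outSum        : OutSumConstraint y
      throughSum    : ThroughSumConstraint y

  -- Integrality of the coordinates is relaxed to membership of [0,1].
  Relaxation : Pred (Point n) 0ℓ → Pred (Point n) 0ℓ
  Relaxation Linear y =
    Linear y × (∀ i j (i≢j : i ≢ j) → 0ℝ ≤ y i j i≢j × y i j i≢j ≤ 1ℝ)

  P¹ P² : Pred (Point n) 0ℓ
  P¹ = Relaxation Constraints₁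
  P² = Relaxation Constraints₂

-- Strict inclusion, with an explicit point in the difference.
infix 4 _⊊_

_⊊_ : {A : Set} → Pred A 0ℓ → Pred A 0ℓ → Set
P ⊊ Q = P ⊆ Q × ∃[ x ] (Q x × ¬ P x)

{-# OPTIONS --safe #-}
-- For pairwise distinct i, j, u, the u-th term of each of (2a), (2b), (2c) is
-- bounded by one instance of (1d), for the triples (u,j,i), (i,u,j) and
-- (i,j,u) respectively; summing over the n − 2 nodes u gives P¹ ⊆ P².
--
-- (2a)–(2c) thus only impose transitivity on average over the third node.  For
-- strictness take four nodes, no arcs, weight 3/4 along the directed cycle
-- 0 → 1 → 2 → 0 (so 1/4 backwards) and 1/2 between node 3 and the others: the
-- cycle violates (1d), but node 3 compensates for it in every sum.
module Submission where

open import Defs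
import Algebra.Properties.CommutativeMonoid.Sum as Sum
import Algebra.Properties.Monoid.Mult as Mult
open import Data.Bool.Base using (false)
open import Data.Fin.Base using (Fin; zero; suc; punchIn; punchOut)
open import Data.Fin.Properties
  using (_≟_; all?; punchInᵢ≢i; punchIn-injective; punchIn-punchOut)
open import Data.Integer.Base using (+_)
open import Data.Nat.Base as ℕ using (ℕ; zero; suc; _∸_)
import Data.Nat.Properties as ℕ
open import Data.Product.Base using (_×_; _,_; ∃-syntax)
open import Data.Rational.Base as ℚ using (ℚ; 0ℚ; 1ℚ; ½; _/_)
import Data.Rational.Properties as ℚ
open import Data.Rational.Solver using (module +-*-Solver)
open import Data.Vec.Base using (Vec; []; _∷_; lookup)
open import Data.Vec.Functional using (removeAt)
open import Function.Base using (_∘_)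
open import Relation.Binary.PropositionalEquality
  using (_≡_; _≢_; refl; sym; trans; cong; cong₂; subst; ≢-sym; module ≡-Reasoning)
open import Relation.Nullary using (¬_; Dec; yes; no; contradiction)
open import Relation.Nullary.Decidable using (from-yes; from-no; map′; True; toWitness)
open import Relation.Unary using (_⊆_)

-- Finite sums of rationals.

open Sum ℚ.+-0-commutativeMonoid
  using (sum-remove; sum-cong-≗; sum-replicate) renaming (sum to ∑)
open Mult ℚ.+-0-monoid using () renaming (_×_ to _⊛_)

-- Delete index `i`, then the position `j′` that `j` takes among the remaining indices; both deleted
-- entries are 0 and `n ∸ 2` copies of `c` are left. Over ℚ the monoid laws hold up to `_≡_`; for
-- reals the lemma is applied at each index of the sequences.
∑-constExceptTwo : ∀ {n} {i j : Fin n} → i ≢ j → ∀ (t : Fin n → ℚ) c →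
  t i ≡ 0ℚ → t j ≡ 0ℚ → (∀ u → u ≢ i → u ≢ j → t u ≡ c) →
  ∑ t ≡ (n ∸ 2) ⊛ c
∑-constExceptTwo {suc zero} {zero} {zero} i≢j = contradiction refl i≢j
∑-constExceptTwo {suc (suc k)} {i} {j} i≢j t c tᵢ≡0 tⱼ≡0 t≡c = begin
  ∑ t                                    ≡⟨ sum-remove {i = i} t ⟩
  t i ℚ.+ ∑ t₁                           ≡⟨ cong₂ ℚ._+_ tᵢ≡0 (sum-remove {i = j′} t₁) ⟩
  0ℚ ℚ.+ (t₁ j′ ℚ.+ ∑ (removeAt t₁ j′))  ≡⟨ ℚ.+-identityˡ _ ⟩
  t₁ j′ ℚ.+ ∑ (removeAt t₁ j′)           ≡⟨ cong₂ ℚ._+_ t₁ⱼ≡0 (sum-cong-≗ t₁≡c) ⟩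
  0ℚ ℚ.+ ∑ {k} (λ _ → c)                 ≡⟨ ℚ.+-identityˡ _ ⟩
  ∑ {k} (λ _ → c)                        ≡⟨ sum-replicate k ⟩
  k ⊛ c                                  ∎
  where
  open ≡-Reasoning

  t₁ : Fin (suc k) → ℚ
  t₁ = removeAt t i

  j′ : Fin (suc k)
  j′ = punchOut i≢j

  t₁ⱼ≡0 : t₁ j′ ≡ 0ℚ
  t₁ⱼ≡0 = trans (cong t (punchIn-punchOut i≢j)) tⱼ≡0

  t₁≡c : ∀ u → removeAt t₁ j′ u ≡ c
  -- A surviving index equal to `j` would, by injectivity of `punchIn i`, sit at the deleted
  -- position `j′`.
  t₁≡c u = t≡c _ (punchInᵢ≢i i _) λ eq → punchInᵢ≢i j′ u
    (punchIn-injective i _ _ (trans eq (sym (punchIn-punchOut i≢j))))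

-- Equality and order of Cauchy reals, term by term.

seq-sum : ∀ {n} (f : Fin n → ℝ) m → seq (sum f) m ≡ ∑ (λ u → seq (f u) m)
seq-sum {zero}  _ _ = refl
seq-sum {suc _} f m = cong (seq (f zero) m ℚ.+_) (seq-sum (f ∘ suc) m)

seq-· : ∀ n x m → seq (n · x) m ≡ n ⊛ seq x m
seq-· zero    _ _ = refl
seq-· (suc n) x m = cong (seq x m ℚ.+_) (seq-· n x m)

infix 4 _≗_

-- Finer than `_≈_`: algebraic rearrangements hold at every index, so they reduce to ring identities
-- in ℚ.
_≗_ : ℝ → ℝ → Set
x ≗ y = ∀ m → seq x m ≡ seq y m

≗⇒≈ : ∀ {x y} → x ≗ y → x ≈ y
≗⇒≈ {x} {y} x≗y ε 0<ε = 0 , λ m _ → subst (λ d → ℚ.∣ d ∣ ℚ.≤ ε)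
  (sym (trans (cong (ℚ._- seq y m) (x≗y m)) (ℚ.+-inverseʳ (seq y m))))
  (ℚ.<⇒≤ 0<ε)

pointwise⇒≤ : ∀ {x y} → (∀ m → seq x m ℚ.≤ seq y m) → x ≤ y
pointwise⇒≤ {x} {y} x≤y ε 0<ε = 0 , λ m _ → ℚ.≤-trans (x≤y m)
  (subst (ℚ._≤ seq y m ℚ.+ ε) (ℚ.+-identityʳ (seq y m))
    (ℚ.+-monoʳ-≤ (seq y m) (ℚ.<⇒≤ 0<ε)))

≤-refl : ∀ {x} → x ≤ x
≤-refl {x} = pointwise⇒≤ {x} {x} λ _ → ℚ.≤-refl

≤-respˡ-≗ : ∀ {x x′ y} → x ≗ x′ → x ≤ y → x′ ≤ y
≤-respˡ-≗ {y = y} x≗x′ x≤y ε 0<ε with N , x≤y+ε ← x≤y ε 0<ε =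
  N , λ m p → subst (ℚ._≤ seq y m ℚ.+ ε) (x≗x′ m) (x≤y+ε m p)

≤-respʳ-≗ : ∀ {x y y′} → y ≗ y′ → x ≤ y → x ≤ y′
≤-respʳ-≗ {x} y≗y′ x≤y ε 0<ε with N , x≤y+ε ← x≤y ε 0<ε =
  N , λ m p → subst (λ q → seq x m ℚ.≤ q ℚ.+ ε) (y≗y′ m) (x≤y+ε m p)

½*-pos : ∀ {p} → 0ℚ ℚ.< p → 0ℚ ℚ.< ½ ℚ.* p
½*-pos {p} 0<p = subst (ℚ._< ½ ℚ.* p) (ℚ.*-zeroʳ ½) (ℚ.*-monoʳ-<-pos ½ 0<p)

+-mono-≤ : ∀ {x y u v} → x ≤ y → u ≤ v → x + u ≤ y + v
+-mono-≤ {x} {y} {u} {v} x≤y u≤v ε 0<ε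
  with M , x≤y+½ε ← x≤y (½ ℚ.* ε) (½*-pos 0<ε)
     | N , u≤v+½ε ← u≤v (½ ℚ.* ε) (½*-pos 0<ε)
  = M ℕ.⊔ N , λ m p → subst (seq x m ℚ.+ seq u m ℚ.≤_)
      (collect (seq y m) (seq v m) ε)
      (ℚ.+-mono-≤ (x≤y+½ε m (ℕ.m⊔n≤o⇒m≤o M N p))
                  (u≤v+½ε m (ℕ.m⊔n≤o⇒n≤o M N p)))
  where
  open +-*-Solver

  collect : ∀ b d e →
    (b ℚ.+ ½ ℚ.* e) ℚ.+ (d ℚ.+ ½ ℚ.* e) ≡ (b ℚ.+ d) ℚ.+ e
  collect = solve 3 (λ b d e →
    (b :+ con ½ :* e) :+ (d :+ con ½ :* e) := (b :+ d) :+ e) refl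

-- Add `x′ - x` to both sides of `x ≤ y`. Rearranging a linear inequality thus takes a single ring
-- identity between the two differences.
≤-resp-gap : ∀ {x y x′ y′} → y - x ≗ y′ - x′ → x ≤ y → x′ ≤ y′
≤-resp-gap {x} {y} {x′} {y′} gap x≤y =
  ≤-respˡ-≗ {x + (x′ - x)} {x′} {y′}
    (λ m → lower (seq x m) (seq x′ m))
    (≤-respʳ-≗ {x + (x′ - x)} {y + (x′ - x)} {y′}
      (λ m → trans (regroup (seq x m) (seq y m) (seq x′ m))
        (trans (cong (ℚ._+ seq x′ m) (gap m)) (upper (seq x′ m) (seq y′ m))))
      (+-mono-≤ {x} {y} {x′ - x} {x′ - x} x≤y (≤-refl {x′ - x})))
  where
  open +-*-Solver

  lower : ∀ a a′ → a ℚ.+ (a′ ℚ.- a) ≡ a′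
  lower = solve 2 (λ a a′ → a :+ (a′ :- a) := a′) refl

  regroup : ∀ a b a′ → b ℚ.+ (a′ ℚ.- a) ≡ (b ℚ.- a) ℚ.+ a′
  regroup = solve 3 (λ a b a′ → b :+ (a′ :- a) := (b :- a) :+ a′) refl

  upper : ∀ a′ b′ → (b′ ℚ.- a′) ℚ.+ a′ ≡ b′
  upper = solve 2 (λ a′ b′ → (b′ :- a′) :+ a′ := b′) refl

sum-mono-≤ : ∀ {n} {f g : Fin n → ℝ} → (∀ u → f u ≤ g u) → sum f ≤ sum g
sum-mono-≤ {zero}          f≤g = ≤-refl {0ℝ}
sum-mono-≤ {suc _} {f} {g} f≤g =
  +-mono-≤ {f zero} {g zero} {sum (f ∘ suc)} {sum (g ∘ suc)}
    (f≤g zero) (sum-mono-≤ {f = f ∘ suc} {g ∘ suc} (f≤g ∘ suc))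

-- Sums over the nodes other than `i` and `j`.

exceptTerm-mono-≤ : ∀ {n} {i j u : Fin n} (d : Dec (u ≡ i)) (e : Dec (u ≡ j))
  {x y : u ≢ i → u ≢ j → ℝ} → (∀ p q → x p q ≤ y p q) →
  exceptTerm d e x ≤ exceptTerm d e y
exceptTerm-mono-≤ (yes _)  _        _   = ≤-refl {0ℝ}
exceptTerm-mono-≤ (no _)   (yes _)  _   = ≤-refl {0ℝ}
exceptTerm-mono-≤ (no u≢i) (no u≢j) x≤y = x≤y u≢i u≢j

-- The decisions are kept arbitrary, since `i ≟ i` does not reduce for a variable `i`; case analysis
-- refutes the wrong answer instead.
exceptTerm-left : ∀ {n} {i j u : Fin n} (d : Dec (u ≡ i)) (e : Dec (u ≡ j))
  {x : u ≢ i → u ≢ j → ℝ} → u ≡ i → exceptTerm d e x ≡ 0ℝ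
exceptTerm-left (yes _)  _ _   = refl
exceptTerm-left (no u≢i) _ u≡i = contradiction u≡i u≢i

exceptTerm-right : ∀ {n} {i j u : Fin n} (d : Dec (u ≡ i)) (e : Dec (u ≡ j))
  {x : u ≢ i → u ≢ j → ℝ} → u ≡ j → exceptTerm d e x ≡ 0ℝ
exceptTerm-right (yes _) _        _   = refl
exceptTerm-right (no _)  (yes _)  _   = refl
exceptTerm-right (no _)  (no u≢j) u≡j = contradiction u≡j u≢j

exceptTerm-const : ∀ {n} {i j u : Fin n} (d : Dec (u ≡ i)) (e : Dec (u ≡ j))
  {c : ℝ} → u ≢ i → u ≢ j → exceptTerm d e (λ _ _ → c) ≡ c
exceptTerm-const (yes u≡i) _         u≢i _   = contradiction u≡i u≢i
exceptTerm-const (no _)    (yes u≡j) _   u≢j = contradiction u≡j u≢j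
exceptTerm-const (no _)    (no _)    _   _   = refl

sumExcept-const : ∀ {n} {i j : Fin n} → i ≢ j → ∀ c →
  sumExcept i j (λ _ _ _ → c) ≗ (n ∸ 2) · c
sumExcept-const {n} {i} {j} i≢j c m = begin
  seq (sumExcept i j (λ _ _ _ → c)) m  ≡⟨ seq-sum t m ⟩
  ∑ (λ u → seq (t u) m)                ≡⟨ ∑-constExceptTwo i≢j _ (seq c m)
                                            (at-m (exceptTerm-left (i ≟ i) (i ≟ j) refl))
                                            (at-m (exceptTerm-right (j ≟ i) (j ≟ j) refl))
                                            (λ u u≢i u≢j →
                                              at-m (exceptTerm-const (u ≟ i) (u ≟ j) u≢i u≢j)) ⟩
  (n ∸ 2) ⊛ seq c m                    ≡⟨ seq-· (n ∸ 2) c m ⟨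
  seq ((n ∸ 2) · c) m                  ∎
  where
  open ≡-Reasoning

  t : Fin n → ℝ
  t u = exceptTerm (u ≟ i) (u ≟ j) (λ _ _ → c)

  at-m : ∀ {x y} → x ≡ y → seq x m ≡ seq y m
  at-m = cong (λ x → seq x m)

module _ {n} {i j : Fin n} (i≢j : i ≢ j) (c : ℝ)
         (f : (u : Fin n) → u ≢ i → u ≢ j → ℝ) where

  -- The bound `c` does not depend on `u`, so summing it over the `n ∸ 2` admissible nodes gives the
  -- multiple on the left, the shape of the bounds in (2a) and (2b).
  sumExcept-lower : (∀ u p q → c ≤ f u p q) → (n ∸ 2) · c ≤ sumExcept i j f
  sumExcept-lower c≤f =
    ≤-respˡ-≗ {sumExcept i j (λ _ _ _ → c)} {(n ∸ 2) · c} {sumExcept i j f}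
      (sumExcept-const i≢j c)
      (sum-mono-≤ λ u → exceptTerm-mono-≤ (u ≟ i) (u ≟ j) (c≤f u))

  sumExcept-upper : (∀ u p q → f u p q ≤ c) → sumExcept i j f ≤ (n ∸ 2) · c
  sumExcept-upper f≤c =
    ≤-respʳ-≗ {sumExcept i j f} {sumExcept i j (λ _ _ _ → c)} {(n ∸ 2) · c}
      (sumExcept-const i≢j c)
      (sum-mono-≤ λ u → exceptTerm-mono-≤ (u ≟ i) (u ≟ j) (f≤c u))

-- From (1d) to the summed constraints: the inclusion.

module _ (x y z : ℝ) (x-y-z≥-1 : x - y - z ≥ - 1ℝ) where
  open +-*-Solver

  triangle-in : z - 1ℝ ≤ x - y
  triangle-in = ≤-resp-gap { - 1ℝ} {x - y - z} {z - 1ℝ} {x - y}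
    (λ m → solve 4 (λ x y z o → (x :- y :- z) :- (:- o) := (x :- y) :- (z :- o))
      refl (seq x m) (seq y m) (seq z m) 1ℚ)
    x-y-z≥-1

  triangle-out : y - 1ℝ ≤ x - z
  triangle-out = ≤-resp-gap { - 1ℝ} {x - y - z} {y - 1ℝ} {x - z}
    (λ m → solve 4 (λ x y z o → (x :- y :- z) :- (:- o) := (x :- z) :- (y :- o))
      refl (seq x m) (seq y m) (seq z m) 1ℚ)
    x-y-z≥-1

  triangle-through : y + z ≤ x + 1ℝ
  triangle-through = ≤-resp-gap { - 1ℝ} {x - y - z} {y + z} {x + 1ℝ}
    (λ m → solve 4 (λ x y z o → (x :- y :- z) :- (:- o) := (x :+ o) :- (y :+ z))
      refl (seq x m) (seq y m) (seq z m) 1ℚ)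
    x-y-z≥-1

P¹⊆P² : ∀ G → P¹ G ⊆ P² G
P¹⊆P² G {y} (c , box) = record
  { bidirectional = bidirectional
  ; exclusive     = exclusive
  ; inSum         = λ i j i≢j → sumExcept-lower i≢j (y i j i≢j - 1ℝ)
      (λ u u≢i u≢j → y u j u≢j - y u i u≢i)
      λ u u≢i u≢j → triangle-in (y u j u≢j) (y u i u≢i) (y i j i≢j)
        (triangle u j i u≢j u≢i i≢j)
  ; outSum        = λ i j i≢j → sumExcept-lower i≢j (y i j i≢j - 1ℝ)
      (λ u u≢i u≢j → y i u (≢-sym u≢i) - y j u (≢-sym u≢j))
      λ u u≢i u≢j →
        triangle-out (y i u (≢-sym u≢i)) (y i j i≢j) (y j u (≢-sym u≢j))
          (triangle i u j (≢-sym u≢i) i≢j (≢-sym u≢j))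
  ; throughSum    = λ i j i≢j → sumExcept-upper i≢j (y i j i≢j + 1ℝ)
      (λ u u≢i u≢j → y i u (≢-sym u≢i) + y u j u≢j)
      λ u u≢i u≢j →
        triangle-through (y i j i≢j) (y i u (≢-sym u≢i)) (y u j u≢j)
          (triangle i j u i≢j (≢-sym u≢i) u≢j)
  } , box
  where open Constraints₁ c

-- The separating instance and point.

arcless : ℕ → Instance
arcless n = record
  { n        = n
  ; arc      = λ _ _ → false
  ; loopless = λ _ ()
  ; weight   = λ _ _ ()
  ; weight≥0 = λ _ _ ()
  }

-- The diagonal zeros are fillers: a `Point` has coordinates only at pairs of distinct nodes.
cycleMatrix : Vec (Vec ℚ 4) 4
cycleMatrix = (0ℚ ∷ ¾  ∷ ¼  ∷ ½  ∷ [])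
            ∷ (¼  ∷ 0ℚ ∷ ¾  ∷ ½  ∷ [])
            ∷ (¾  ∷ ¼  ∷ 0ℚ ∷ ½  ∷ [])
            ∷ (½  ∷ ½  ∷ ½  ∷ 0ℚ ∷ [])
            ∷ []
  where
  ¼ ¾ : ℚ
  ¼ = + 1 / 4
  ¾ = + 3 / 4

cyclePoint : Point 4
cyclePoint i j _ = fromℚ (lookup (lookup cycleMatrix i) j)

-- Diagonal pairs hold vacuously. Elsewhere `P` takes the proof of `i ≢ j` irrelevantly, so deciding
-- it at one proof settles it for all.
all≢? : ∀ {n} {P : (i j : Fin n) → .(i ≢ j) → Set} →
  (∀ i j .(i≢j : i ≢ j) → Dec (P i j i≢j)) →
  Dec (∀ i j (i≢j : i ≢ j) → P i j i≢j)
all≢? {n} {P} P? = all? λ i → all? λ j → at i j (i ≟ j)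
  where
  at : ∀ i j → Dec (i ≡ j) → Dec ((i≢j : i ≢ j) → P i j i≢j)
  at i j (yes i≡j) = yes λ i≢j → contradiction i≡j i≢j
  at i j (no i≢j)  = map′ (λ p _ → p) (λ p → p i≢j) (P? i j i≢j)

pointwise≤? : ∀ {n} (x y : Point n) m →
  Dec (∀ i j (i≢j : i ≢ j) → seq (x i j i≢j) m ℚ.≤ seq (y i j i≢j) m)
pointwise≤? x y m =
  all≢? λ i j i≢j → seq (x i j i≢j) m ℚ.≤? seq (y i j i≢j) m

-- A record, so that Agda infers x and y from the type of an element.
record PointwiseDecided≤ {n} (x y : Point n) : Set where
  field holds : ∀ m → True (pointwise≤? x y m)

≤-decide : ∀ {n} {x y : Point n} → PointwiseDecided≤ x y →
  ∀ i j (i≢j : i ≢ j) → x i j i≢j ≤ y i j i≢j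
≤-decide {x = x} {y} x≤y i j i≢j =
  pointwise⇒≤ {x i j i≢j} {y i j i≢j} λ m → toWitness (holds m) i j i≢j
  where open PointwiseDecided≤ x≤y

-- Stated for variables G and y, because for a concrete n Agda compares the
-- sums below with those in the constraints by unfolding their Cauchy proofs.
module _ (G : Instance) (y : Point (Instance.n G)) where
  open Instance G using (n)

  inSum-decide : PointwiseDecided≤
      (λ i j i≢j → (n ∸ 2) · (y i j i≢j - 1ℝ))
      (λ i j _ → sumExcept i j λ u u≢i u≢j → y u j u≢j - y u i u≢i) →
    InSumConstraint G y
  inSum-decide = ≤-decide

  outSum-decide : PointwiseDecided≤
      (λ i j i≢j → (n ∸ 2) · (y i j i≢j - 1ℝ))
      (λ i j _ → sumExcept i j λ u u≢i u≢j →
        y i u (≢-sym u≢i) - y j u (≢-sym u≢j)) →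
    OutSumConstraint G y
  outSum-decide = ≤-decide

  throughSum-decide : PointwiseDecided≤
      (λ i j _ → sumExcept i j λ u u≢i u≢j →
        y i u (≢-sym u≢i) + y u j u≢j)
      (λ i j i≢j → (n ∸ 2) · (y i j i≢j + 1ℝ)) →
    ThroughSumConstraint G y
  throughSum-decide = ≤-decide

-- The coordinates are constant sequences, so the decisions evaluate although
-- the index m is a variable.
cyclePoint∈P² : P² (arcless 4) cyclePoint
cyclePoint∈P² = record
  -- Without arcs (1b) is vacuous, while (1c) binds every pair of distinct nodes.
  { bidirectional = λ _ _ _ ()
  ; exclusive     = λ i j i≢j _ →
      ≗⇒≈ {cyclePoint i j i≢j + cyclePoint j i (≢-sym i≢j)} {1ℝ}
        -- The sequences are constant, so the equation at index 0 serves at every index.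
        λ _ → exclusive i j i≢j
  ; inSum         = inSum-decide (arcless 4) cyclePoint _
  ; outSum        = outSum-decide (arcless 4) cyclePoint _
  ; throughSum    = throughSum-decide (arcless 4) cyclePoint _
  } , λ i j i≢j → ≤-decide {x = λ _ _ _ → 0ℝ} {cyclePoint} _ i j i≢j
                , ≤-decide {x = cyclePoint} {λ _ _ _ → 1ℝ} _ i j i≢j
  where
  exclusive : ∀ i j (i≢j : i ≢ j) →
    seq (cyclePoint i j i≢j) 0 ℚ.+ seq (cyclePoint j i (≢-sym i≢j)) 0 ≡ 1ℚ
  exclusive = from-yes (all≢? λ i j i≢j →
    (seq (cyclePoint i j i≢j) 0 ℚ.+ seq (cyclePoint j i (≢-sym i≢j)) 0) ℚ.≟ 1ℚ)

cyclePoint∉P¹ : ¬ P¹ (arcless 4) cyclePoint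
cyclePoint∉P¹ (c , _)
  with N , -1≤x+ε ← Constraints₁.triangle c
         -- The path 0 → 1 → 2 has weight 3/4 on both steps but 0 → 2 only 1/4, so (1d) fails by
         -- 1/4. The tolerance 1/8 is smaller than this violation, leaving the false inequality -1 ≤
         -- -9/8.
         zero (suc (suc zero)) (suc zero) (λ ()) (λ ()) (λ ())
         (+ 1 / 8) (from-yes (0ℚ ℚ.<? + 1 / 8))
  -- The left-hand side of (1d) is ¼ − ¾ − ¾ = −5/4.
  = from-no (ℚ.- 1ℚ ℚ.≤? ℚ.- (+ 5 / 4) ℚ.+ + 1 / 8) (-1≤x+ε N ℕ.≤-refl)

theorem2 : (∀ (G : Instance) → P¹ G ⊆ P² G) × (∃[ G ] (P¹ G ⊊ P² G))
theorem2 = P¹⊆P²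
         , arcless 4 , P¹⊆P² (arcless 4) , cyclePoint , cyclePoint∈P² , cyclePoint∉P¹
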